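{- Let $(G_m)_{m\in\mathbb{Z}}$ be a generalized Fibonacci sequence and let $n\ge 0$ be an integer. Then $$\sum_{k=0}^n k\, G_k G_{n-k} = \frac{1}{10}\, n \left\{ \left[ (3n+5)G_0 - (n+1)G_1 \right] G_n - \left[ (n-1)G_0 - 2nG_1 \right] G_{n+1} \right\}.$$
   Context: A generalized Fibonacci sequence is a sequence $(G_m)_{m\in\mathbb{Z}}$ of complex numbers with $G_{m+2}=G_{m+1}+G_m$ for all integers $m$ (with arbitrary seed $G_0,G_1$). -}

module Defs where

open import Algebra.Bundles using (CommutativeRing)
open import Data.Integer.Base as ℤ using (ℤ)
open import Data.List.Base using ([]; _∷_)
open import Data.Nat.Base as ℕ using (ℕ)
import Data.Nat.Properties as ℕ
open import Data.Product.Base using (∃-syntax; _×_; _,_)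
open import Data.Rational.Base as ℚ
  using (ℚ; 0ℚ; 1ℚ; ½; ∣_∣; Positive; _+_; _*_; _-_; -_; _<_; _≤_)
import Data.Rational.Properties as ℚ
open import Level using (0ℓ)
open import Relation.Nullary.Decidable using (dec⇒maybe)
open import Relation.Binary.PropositionalEquality
  using (_≡_; refl; sym; trans; cong; subst)
open import Tactic.RingSolver using (solve)
open import Tactic.RingSolver.Core.AlmostCommutativeRing
  using (AlmostCommutativeRing; fromCommutativeRing)

private
  ℚ-ring : AlmostCommutativeRing 0ℓ 0ℓ
  ℚ-ring = fromCommutativeRing ℚ.+-*-commutativeRing (λ p → dec⇒maybe (0ℚ ℚ.≟ p))

  opaque
    half : ℚ → ℚ
    half ε = ½ * ε

    half-pos : ∀ ε → .{{Positive ε}} → Positive (half ε)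
    half-pos ε = ℚ.pos*pos⇒pos ½ ε

    half+half : ∀ ε → half ε + half ε ≡ ε
    half+half ε = trans (sym (ℚ.*-distribʳ-+ ε ½ ½)) (ℚ.*-identityˡ ε)

  opaque
    0<ε : ∀ ε → .{{Positive ε}} → ∣ 0ℚ ∣ < ε
    0<ε ε = ℚ.positive⁻¹ ε

    ∣p-q∣≡∣q-p∣ : ∀ p q → ∣ p - q ∣ ≡ ∣ q - p ∣
    ∣p-q∣≡∣q-p∣ p q = trans (cong ∣_∣ eq) (ℚ.∣-p∣≡∣p∣ (q - p))
      where
      eq : p - q ≡ - (q - p)
      eq = solve (p ∷ q ∷ []) ℚ-ring

    halves : ∀ ε p q {r} → r ≡ p + q → ∣ p ∣ < half ε → ∣ q ∣ < half ε → ∣ r ∣ < ε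
    halves ε p q {r} r≡p+q p< q< = begin-strict
      ∣ r ∣              ≡⟨ cong ∣_∣ r≡p+q ⟩
      ∣ p + q ∣          ≤⟨ ℚ.∣p+q∣≤∣p∣+∣q∣ p q ⟩
      ∣ p ∣ + ∣ q ∣      <⟨ ℚ.+-mono-< p< q< ⟩
      half ε + half ε    ≡⟨ half+half ε ⟩
      ε                  ∎
      where open ℚ.≤-Reasoning

    +-close : ∀ ε p p′ q q′ → ∣ p - p′ ∣ < half ε → ∣ q - q′ ∣ < half ε →
              ∣ (p + q) - (p′ + q′) ∣ < ε
    +-close ε p p′ q q′ = halves ε (p - p′) (q - q′) eq
      where
      eq : (p + q) - (p′ + q′) ≡ (p - p′) + (q - q′)
      eq = solve (p ∷ p′ ∷ q ∷ q′ ∷ []) ℚ-ring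

    neg-close : ∀ {ε} p q → ∣ p - q ∣ < ε → ∣ - p - - q ∣ < ε
    neg-close {ε} p q = subst (_< ε) (trans (∣p-q∣≡∣q-p∣ p q) (cong ∣_∣ eq))
      where
      eq : q - p ≡ - p - - q
      eq = solve (p ∷ q ∷ []) ℚ-ring

    trans-close : ∀ ε p q r → ∣ p - q ∣ < half ε → ∣ q - r ∣ < half ε → ∣ p - r ∣ < ε
    trans-close ε p q r = halves ε (p - q) (q - r) eq
      where
      eq : p - r ≡ (p - q) + (q - r)
      eq = solve (p ∷ q ∷ r ∷ []) ℚ-ring

    quotient : ∀ δ b → .{{Positive δ}} → .{{Positive b}} →
               ∃[ η ] (Positive η × b * η ≡ δ)
    quotient δ b = b⁻¹ * δ , ℚ.pos*pos⇒pos b⁻¹ {{ℚ.1/pos⇒pos b}} δ , eq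
      where
      instance
        b≢0 : ℚ.NonZero b
        b≢0 = ℚ.pos⇒nonZero b
      b⁻¹ : ℚ
      b⁻¹ = ℚ.1/ b
      eq : b * (b⁻¹ * δ) ≡ δ
      eq = trans (sym (ℚ.*-assoc b b⁻¹ δ))
             (trans (cong (_* δ) (ℚ.*-inverseʳ b)) (ℚ.*-identityˡ δ))

    *-small : ∀ b {δ η} p q → .{{Positive b}} → b * η ≡ δ →
              ∣ p ∣ ≤ b → ∣ q ∣ < η → ∣ p * q ∣ < δ
    *-small b {δ} {η} p q bη≡δ p≤ q< = begin-strict
      ∣ p * q ∣        ≡⟨ ℚ.∣p*q∣≡∣p∣*∣q∣ p q ⟩
      ∣ p ∣ * ∣ q ∣    ≤⟨ ℚ.*-monoʳ-≤-nonNeg ∣ q ∣ {{ℚ.∣-∣-nonNeg q}} p≤ ⟩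
      b * ∣ q ∣        <⟨ ℚ.*-monoʳ-<-pos b q< ⟩
      b * η            ≡⟨ bη≡δ ⟩
      δ                ∎
      where open ℚ.≤-Reasoning

    *-close : ∀ ε a b {η θ} p p′ q q′ → .{{Positive a}} → .{{Positive b}} →
              a * η ≡ half ε → b * θ ≡ half ε →
              ∣ p ∣ ≤ a → ∣ q′ ∣ ≤ b → ∣ p - p′ ∣ < θ → ∣ q - q′ ∣ < η →
              ∣ p * q - p′ * q′ ∣ < ε
    *-close ε a b p p′ q q′ aη bθ p≤ q′≤ p< q< =
      halves ε (p * (q - q′)) (q′ * (p - p′)) eq
        (*-small a p (q - q′) aη p≤ q<) (*-small b q′ (p - p′) bθ q′≤ p<)
      where
      eq : p * q - p′ * q′ ≡ p * (q - q′) + q′ * (p - p′)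
      eq = solve (p ∷ p′ ∷ q ∷ q′ ∷ []) ℚ-ring

IsCauchy : (ℕ → ℚ) → Set
IsCauchy x = ∀ ε → .{{Positive ε}} →
  ∃[ N ] (∀ m n → N ℕ.≤ m → N ℕ.≤ n → ∣ x m - x n ∣ < ε)

-- ℝ is the set of Cauchy sequences in ℚ; it is not quotiented, so equality of
-- reals is _≈ᴿ_ (the difference tends to 0), never _≡_.  Likewise for ℂ and _≈ᶜ_.
record ℝ : Set where
  constructor mkℝ
  field
    seq    : ℕ → ℚ
    cauchy : IsCauchy seq

open ℝ public

infix 4 _≈ᴿ_

-- A record rather than a function into Set, so that x and y can be inferred
-- from a proof of x ≈ᴿ y.
record _≈ᴿ_ (x y : ℝ) : Set where
  constructor mk≈
  field
    close : ∀ ε → .{{Positive ε}} → ∃[ N ] (∀ n → N ℕ.≤ n → ∣ seq x n - seq y n ∣ < ε)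

open _≈ᴿ_ public

private
  ≤⊔ˡ : ∀ {m n o} → m ℕ.⊔ n ℕ.≤ o → m ℕ.≤ o
  ≤⊔ˡ {m} {n} = ℕ.≤-trans (ℕ.m≤m⊔n m n)

  ≤⊔ʳ : ∀ {m n o} → m ℕ.⊔ n ℕ.≤ o → n ℕ.≤ o
  ≤⊔ʳ {m} {n} = ℕ.≤-trans (ℕ.m≤n⊔m m n)

  ≡⇒≈ᴿ : ∀ {x y} → (∀ n → seq x n ≡ seq y n) → x ≈ᴿ y
  ≡⇒≈ᴿ {x} {y} x≡y = mk≈ λ ε → 0 , λ n _ →
    subst (λ p → ∣ p ∣ < ε)
      (sym (trans (cong (_- seq y n) (x≡y n)) (ℚ.+-inverseʳ (seq y n)))) (0<ε ε)

  opaque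
    eventually-bounded : ∀ x → ∃[ b ] (Positive b × ∃[ N ] (∀ n → N ℕ.≤ n → ∣ seq x n ∣ ≤ b))
    eventually-bounded x with cauchy x 1ℚ
    ... | N , close =
      ∣ xN ∣ + 1ℚ , ℚ.nonNeg+pos⇒pos ∣ xN ∣ {{ℚ.∣-∣-nonNeg xN}} 1ℚ , N , bound
      where
      open ℚ.≤-Reasoning
      xN : ℚ
      xN = seq x N
      eq : ∀ p q → p ≡ q + (p - q)
      eq p q = solve (p ∷ q ∷ []) ℚ-ring
      bound : ∀ n → N ℕ.≤ n → ∣ seq x n ∣ ≤ ∣ xN ∣ + 1ℚ
      bound n N≤n = begin
        ∣ seq x n ∣                  ≡⟨ cong ∣_∣ (eq (seq x n) xN) ⟩
        ∣ xN + (seq x n - xN) ∣      ≤⟨ ℚ.∣p+q∣≤∣p∣+∣q∣ xN (seq x n - xN) ⟩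
        ∣ xN ∣ + ∣ seq x n - xN ∣    ≤⟨ ℚ.+-monoʳ-≤ ∣ xN ∣ (ℚ.<⇒≤ (close n N N≤n ℕ.≤-refl)) ⟩
        ∣ xN ∣ + 1ℚ                  ∎

    +-cauchy : ∀ x y → IsCauchy (λ n → seq x n + seq y n)
    +-cauchy x y ε =
      let M , p = cauchy x (half ε) {{half-pos ε}}
          N , q = cauchy y (half ε) {{half-pos ε}}
      in M ℕ.⊔ N , λ m n h k →
        +-close ε (seq x m) (seq x n) (seq y m) (seq y n)
          (p m n (≤⊔ˡ h) (≤⊔ˡ k)) (q m n (≤⊔ʳ {M} h) (≤⊔ʳ {M} k))

    neg-cauchy : ∀ x → IsCauchy (λ n → - seq x n)
    neg-cauchy x ε = let N , p = cauchy x ε in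
      N , λ m n h k → neg-close (seq x m) (seq x n) (p m n h k)

    *-cauchy : ∀ x y → IsCauchy (λ n → seq x n * seq y n)
    *-cauchy x y ε =
      let a , a>0 , K , x≤a = eventually-bounded x
          b , b>0 , L , y≤b = eventually-bounded y
          η , η>0 , aη = quotient (half ε) a {{half-pos ε}} {{a>0}}
          θ , θ>0 , bθ = quotient (half ε) b {{half-pos ε}} {{b>0}}
          M , p = cauchy x θ {{θ>0}}
          N , q = cauchy y η {{η>0}}
      in (K ℕ.⊔ L) ℕ.⊔ (M ℕ.⊔ N) , λ m n h k →
        *-close ε a b (seq x m) (seq x n) (seq y m) (seq y n) {{a>0}} {{b>0}} aη bθ
          (x≤a m (≤⊔ˡ {K} (≤⊔ˡ h))) (y≤b n (≤⊔ʳ {K} (≤⊔ˡ k)))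
          (p m n (≤⊔ˡ {M} (≤⊔ʳ {K ℕ.⊔ L} h)) (≤⊔ˡ {M} (≤⊔ʳ {K ℕ.⊔ L} k)))
          (q m n (≤⊔ʳ {M} (≤⊔ʳ {K ℕ.⊔ L} h)) (≤⊔ʳ {M} (≤⊔ʳ {K ℕ.⊔ L} k)))

    const-cauchy : ∀ q → IsCauchy (λ _ → q)
    const-cauchy q ε = 0 , λ _ _ _ _ →
      subst (λ p → ∣ p ∣ < ε) (sym (ℚ.+-inverseʳ q)) (0<ε ε)

infixl 6 _+ᴿ_
infixl 7 _*ᴿ_
infix  8 -ᴿ_

_+ᴿ_ : ℝ → ℝ → ℝ
x +ᴿ y = mkℝ (λ n → seq x n + seq y n) (+-cauchy x y)

_*ᴿ_ : ℝ → ℝ → ℝ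
x *ᴿ y = mkℝ (λ n → seq x n * seq y n) (*-cauchy x y)

-ᴿ_ : ℝ → ℝ
-ᴿ x = mkℝ (λ n → - seq x n) (neg-cauchy x)

ℚ→ℝ : ℚ → ℝ
ℚ→ℝ q = mkℝ (λ _ → q) (const-cauchy q)

private
  opaque
    ≈ᴿ-refl : ∀ {x} → x ≈ᴿ x
    ≈ᴿ-refl = ≡⇒≈ᴿ λ _ → refl

    ≈ᴿ-sym : ∀ {x y} → x ≈ᴿ y → y ≈ᴿ x
    ≈ᴿ-sym {x} {y} x≈y = mk≈ λ ε → let N , p = close x≈y ε in
      N , λ n h → subst (_< ε) (∣p-q∣≡∣q-p∣ (seq x n) (seq y n)) (p n h)

    ≈ᴿ-trans : ∀ {x y z} → x ≈ᴿ y → y ≈ᴿ z → x ≈ᴿ z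
    ≈ᴿ-trans {x} {y} {z} x≈y y≈z = mk≈ λ ε →
      let M , p = close x≈y (half ε) {{half-pos ε}}
          N , q = close y≈z (half ε) {{half-pos ε}}
      in M ℕ.⊔ N , λ n h →
        trans-close ε (seq x n) (seq y n) (seq z n) (p n (≤⊔ˡ h)) (q n (≤⊔ʳ {M} h))

    +ᴿ-cong : ∀ {x x′ y y′} → x ≈ᴿ x′ → y ≈ᴿ y′ → x +ᴿ y ≈ᴿ x′ +ᴿ y′
    +ᴿ-cong {x} {x′} {y} {y′} x≈x′ y≈y′ = mk≈ λ ε →
      let M , p = close x≈x′ (half ε) {{half-pos ε}}
          N , q = close y≈y′ (half ε) {{half-pos ε}}
      in M ℕ.⊔ N , λ n h → +-close ε (seq x n) (seq x′ n) (seq y n) (seq y′ n) (p n (≤⊔ˡ h)) (q n (≤⊔ʳ {M} h))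

    -ᴿ-cong : ∀ {x x′} → x ≈ᴿ x′ → -ᴿ x ≈ᴿ -ᴿ x′
    -ᴿ-cong {x} {x′} x≈x′ = mk≈ λ ε → let N , p = close x≈x′ ε in
      N , λ n h → neg-close (seq x n) (seq x′ n) (p n h)

    *ᴿ-cong : ∀ {x x′ y y′} → x ≈ᴿ x′ → y ≈ᴿ y′ → x *ᴿ y ≈ᴿ x′ *ᴿ y′
    *ᴿ-cong {x} {x′} {y} {y′} x≈x′ y≈y′ = mk≈ λ ε →
      let a , a>0 , K , x≤a  = eventually-bounded x
          b , b>0 , L , y′≤b = eventually-bounded y′
          η , η>0 , aη = quotient (half ε) a {{half-pos ε}} {{a>0}}
          θ , θ>0 , bθ = quotient (half ε) b {{half-pos ε}} {{b>0}}
          M , p = close x≈x′ θ {{θ>0}}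
          N , q = close y≈y′ η {{η>0}}
      in (K ℕ.⊔ L) ℕ.⊔ (M ℕ.⊔ N) , λ n h →
        *-close ε a b (seq x n) (seq x′ n) (seq y n) (seq y′ n) {{a>0}} {{b>0}} aη bθ
          (x≤a n (≤⊔ˡ {K} (≤⊔ˡ h))) (y′≤b n (≤⊔ʳ {K} (≤⊔ˡ h)))
          (p n (≤⊔ˡ {M} (≤⊔ʳ {K ℕ.⊔ L} h))) (q n (≤⊔ʳ {M} (≤⊔ʳ {K ℕ.⊔ L} h)))

ℝ-commutativeRing : CommutativeRing 0ℓ 0ℓ
ℝ-commutativeRing = record
  { Carrier = ℝ
  ; _≈_ = _≈ᴿ_
  ; _+_ = _+ᴿ_
  ; _*_ = _*ᴿ_
  ; -_  = -ᴿ_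
  ; 0#  = ℚ→ℝ 0ℚ
  ; 1#  = ℚ→ℝ 1ℚ
  ; isCommutativeRing = record
    { isRing = record
      { +-isAbelianGroup = record
        { isGroup = record
          { isMonoid = record
            { isSemigroup = record
              { isMagma = record
                { isEquivalence = record { refl = ≈ᴿ-refl ; sym = ≈ᴿ-sym ; trans = ≈ᴿ-trans }
                ; ∙-cong = +ᴿ-cong
                }
              ; assoc = λ x y z → ≡⇒≈ᴿ λ n → ℚ.+-assoc (seq x n) (seq y n) (seq z n)
              }
            ; identity = (λ x → ≡⇒≈ᴿ λ n → ℚ.+-identityˡ (seq x n))
                       , (λ x → ≡⇒≈ᴿ λ n → ℚ.+-identityʳ (seq x n))
            }
          ; inverse = (λ x → ≡⇒≈ᴿ λ n → ℚ.+-inverseˡ (seq x n))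
                    , (λ x → ≡⇒≈ᴿ λ n → ℚ.+-inverseʳ (seq x n))
          ; ⁻¹-cong = -ᴿ-cong
          }
        ; comm = λ x y → ≡⇒≈ᴿ λ n → ℚ.+-comm (seq x n) (seq y n)
        }
      ; *-cong = *ᴿ-cong
      ; *-assoc = λ x y z → ≡⇒≈ᴿ λ n → ℚ.*-assoc (seq x n) (seq y n) (seq z n)
      ; *-identity = (λ x → ≡⇒≈ᴿ λ n → ℚ.*-identityˡ (seq x n))
                   , (λ x → ≡⇒≈ᴿ λ n → ℚ.*-identityʳ (seq x n))
      ; distrib = (λ x y z → ≡⇒≈ᴿ λ n → ℚ.*-distribˡ-+ (seq x n) (seq y n) (seq z n))
                , (λ x y z → ≡⇒≈ᴿ λ n → ℚ.*-distribʳ-+ (seq x n) (seq y n) (seq z n))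
      }
    ; *-comm = λ x y → ≡⇒≈ᴿ λ n → ℚ.*-comm (seq x n) (seq y n)
    }
  }

infix  5 _+i_
infix  4 _≈ᶜ_
infixl 6 _+ᶜ_
infixl 7 _*ᶜ_
infix  8 -ᶜ_

record ℂ : Set where
  constructor _+i_
  field
    re im : ℝ

open ℂ public

record _≈ᶜ_ (z w : ℂ) : Set where
  constructor mk≈ᶜ
  field
    re-≈ : re z ≈ᴿ re w
    im-≈ : im z ≈ᴿ im w

open _≈ᶜ_ public

_+ᶜ_ : ℂ → ℂ → ℂ
(a +i b) +ᶜ (c +i d) = (a +ᴿ c) +i (b +ᴿ d)

_*ᶜ_ : ℂ → ℂ → ℂ
(a +i b) *ᶜ (c +i d) = (a *ᴿ c +ᴿ -ᴿ (b *ᴿ d)) +i (a *ᴿ d +ᴿ b *ᴿ c)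

-ᶜ_ : ℂ → ℂ
-ᶜ (a +i b) = (-ᴿ a) +i (-ᴿ b)

ℝ→ℂ : ℝ → ℂ
ℝ→ℂ a = a +i ℚ→ℝ 0ℚ

private
  module R = CommutativeRing ℝ-commutativeRing

  ≡⇒≈ᶜ : ∀ {z w} → (∀ n → seq (re z) n ≡ seq (re w) n) →
         (∀ n → seq (im z) n ≡ seq (im w) n) → z ≈ᶜ w
  ≡⇒≈ᶜ re≡ im≡ = mk≈ᶜ (≡⇒≈ᴿ re≡) (≡⇒≈ᴿ im≡)

  opaque
    *-assoc-re : ∀ a b c d e f →
      (a * c - b * d) * e - (a * d + b * c) * f ≡
      a * (c * e - d * f) - b * (c * f + d * e)
    *-assoc-re a b c d e f = solve (a ∷ b ∷ c ∷ d ∷ e ∷ f ∷ []) ℚ-ring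

    *-assoc-im : ∀ a b c d e f →
      (a * c - b * d) * f + (a * d + b * c) * e ≡
      a * (c * f + d * e) + b * (c * e - d * f)
    *-assoc-im a b c d e f = solve (a ∷ b ∷ c ∷ d ∷ e ∷ f ∷ []) ℚ-ring

    *-comm-re : ∀ a b c d → a * c - b * d ≡ c * a - d * b
    *-comm-re a b c d = solve (a ∷ b ∷ c ∷ d ∷ []) ℚ-ring

    *-comm-im : ∀ a b c d → a * d + b * c ≡ c * b + d * a
    *-comm-im a b c d = solve (a ∷ b ∷ c ∷ d ∷ []) ℚ-ring

    *-identityˡ-re : ∀ a b → 1ℚ * a - 0ℚ * b ≡ a
    *-identityˡ-re a b = solve (a ∷ b ∷ []) ℚ-ring

    *-identityˡ-im : ∀ a b → 1ℚ * b + 0ℚ * a ≡ b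
    *-identityˡ-im a b = solve (a ∷ b ∷ []) ℚ-ring

    *-identityʳ-re : ∀ a b → a * 1ℚ - b * 0ℚ ≡ a
    *-identityʳ-re a b = solve (a ∷ b ∷ []) ℚ-ring

    *-identityʳ-im : ∀ a b → a * 0ℚ + b * 1ℚ ≡ b
    *-identityʳ-im a b = solve (a ∷ b ∷ []) ℚ-ring

    distribˡ-re : ∀ a b c d e f →
      a * (c + e) - b * (d + f) ≡
      (a * c - b * d) + (a * e - b * f)
    distribˡ-re a b c d e f = solve (a ∷ b ∷ c ∷ d ∷ e ∷ f ∷ []) ℚ-ring

    distribˡ-im : ∀ a b c d e f →
      a * (d + f) + b * (c + e) ≡
      (a * d + b * c) + (a * f + b * e)
    distribˡ-im a b c d e f = solve (a ∷ b ∷ c ∷ d ∷ e ∷ f ∷ []) ℚ-ring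

    distribʳ-re : ∀ a b c d e f →
      (c + e) * a - (d + f) * b ≡
      (c * a - d * b) + (e * a - f * b)
    distribʳ-re a b c d e f = solve (a ∷ b ∷ c ∷ d ∷ e ∷ f ∷ []) ℚ-ring

    distribʳ-im : ∀ a b c d e f →
      (c + e) * b + (d + f) * a ≡
      (c * b + d * a) + (e * b + f * a)
    distribʳ-im a b c d e f = solve (a ∷ b ∷ c ∷ d ∷ e ∷ f ∷ []) ℚ-ring

ℂ-commutativeRing : CommutativeRing 0ℓ 0ℓ
ℂ-commutativeRing = record
  { Carrier = ℂ
  ; _≈_ = _≈ᶜ_
  ; _+_ = _+ᶜ_
  ; _*_ = _*ᶜ_
  ; -_  = -ᶜ_
  ; 0#  = ℝ→ℂ (ℚ→ℝ 0ℚ)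
  ; 1#  = ℝ→ℂ (ℚ→ℝ 1ℚ)
  ; isCommutativeRing = record
    { isRing = record
      { +-isAbelianGroup = record
        { isGroup = record
          { isMonoid = record
            { isSemigroup = record
              { isMagma = record
                { isEquivalence = record
                  { refl  = mk≈ᶜ R.refl R.refl
                  ; sym   = λ p → mk≈ᶜ (R.sym (re-≈ p)) (R.sym (im-≈ p))
                  ; trans = λ p q → mk≈ᶜ (R.trans (re-≈ p) (re-≈ q)) (R.trans (im-≈ p) (im-≈ q))
                  }
                ; ∙-cong = λ p q → mk≈ᶜ (R.+-cong (re-≈ p) (re-≈ q)) (R.+-cong (im-≈ p) (im-≈ q))
                }
              ; assoc = λ x y z → mk≈ᶜ (R.+-assoc (re x) (re y) (re z)) (R.+-assoc (im x) (im y) (im z))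
              }
            ; identity = (λ x → mk≈ᶜ (R.+-identityˡ (re x)) (R.+-identityˡ (im x)))
                       , (λ x → mk≈ᶜ (R.+-identityʳ (re x)) (R.+-identityʳ (im x)))
            }
          ; inverse = (λ x → mk≈ᶜ (R.-‿inverseˡ (re x)) (R.-‿inverseˡ (im x)))
                    , (λ x → mk≈ᶜ (R.-‿inverseʳ (re x)) (R.-‿inverseʳ (im x)))
          ; ⁻¹-cong = λ p → mk≈ᶜ (R.-‿cong (re-≈ p)) (R.-‿cong (im-≈ p))
          }
        ; comm = λ x y → mk≈ᶜ (R.+-comm (re x) (re y)) (R.+-comm (im x) (im y))
        }
      ; *-cong = λ p q → mk≈ᶜ
          (R.+-cong (R.*-cong (re-≈ p) (re-≈ q)) (R.-‿cong (R.*-cong (im-≈ p) (im-≈ q))))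
          (R.+-cong (R.*-cong (re-≈ p) (im-≈ q)) (R.*-cong (im-≈ p) (re-≈ q)))
      ; *-assoc = λ { (a +i b) (c +i d) (e +i f) →
          ≡⇒≈ᶜ
            (λ n → *-assoc-re (seq a n) (seq b n) (seq c n) (seq d n) (seq e n) (seq f n))
            (λ n → *-assoc-im (seq a n) (seq b n) (seq c n) (seq d n) (seq e n) (seq f n)) }
      ; *-identity = (λ { (a +i b) → ≡⇒≈ᶜ
                       (λ n → *-identityˡ-re (seq a n) (seq b n))
                       (λ n → *-identityˡ-im (seq a n) (seq b n)) })
                   , (λ { (a +i b) → ≡⇒≈ᶜ
                       (λ n → *-identityʳ-re (seq a n) (seq b n))
                       (λ n → *-identityʳ-im (seq a n) (seq b n)) })
      ; distrib = (λ { (a +i b) (c +i d) (e +i f) →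
                    ≡⇒≈ᶜ
                      (λ n → distribˡ-re (seq a n) (seq b n) (seq c n) (seq d n) (seq e n) (seq f n))
                      (λ n → distribˡ-im (seq a n) (seq b n) (seq c n) (seq d n) (seq e n) (seq f n)) })
                , (λ { (a +i b) (c +i d) (e +i f) →
                    ≡⇒≈ᶜ
                      (λ n → distribʳ-re (seq a n) (seq b n) (seq c n) (seq d n) (seq e n) (seq f n))
                      (λ n → distribʳ-im (seq a n) (seq b n) (seq c n) (seq d n) (seq e n) (seq f n)) })
      }
    ; *-comm = λ { (a +i b) (c +i d) → ≡⇒≈ᶜ
        (λ n → *-comm-re (seq a n) (seq b n) (seq c n) (seq d n))
        (λ n → *-comm-im (seq a n) (seq b n) (seq c n) (seq d n)) }
    }
  }

ℚ→ℂ : ℚ → ℂ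
ℚ→ℂ q = ℝ→ℂ (ℚ→ℝ q)

ℤ→ℂ : ℤ → ℂ
ℤ→ℂ k = ℚ→ℂ (k ℚ./ 1)

IsGeneralizedFibonacci : (ℤ → ℂ) → Set
IsGeneralizedFibonacci G = ∀ m → G (m ℤ.+ ℤ.+ 2) ≈ᶜ G (m ℤ.+ ℤ.+ 1) +ᶜ G m

infixl 6 _-ᶜ_

_-ᶜ_ : ℂ → ℂ → ℂ
z -ᶜ w = z +ᶜ -ᶜ w

open import Algebra.Properties.Monoid.Sum (CommutativeRing.+-monoid ℂ-commutativeRing) public
  using (sum⁺-syntax)

{-# OPTIONS --safe #-}

-- Reversing the order of summation pairs the weights k and n − k, so the
-- weighted sum is n/2 times the plain convolution Σ G_k G_{n−k}.  The
-- convolution of two sequences f, g satisfying the Fibonacci recurrence has a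
-- closed form which follows by induction on n: removing the term k = 0 leaves
-- the convolution of the shifted sequence f(1 + k) with g.  Allowing f ≠ g is
-- what makes this induction possible.

module Submission where

open import Defs
open import Data.Fin.Base using (toℕ)
open import Data.Integer.Base using (ℤ; +_; _+_; _*_; _-_)
open import Data.Nat.Base using (ℕ)
open import Data.Rational.Base using (_/_)

open import Algebra.Bundles using (CommutativeRing)
import Algebra.Properties.Semiring.Sum as Sum
import Algebra.Solver.Ring as RingSolver
open import Algebra.Solver.Ring.AlmostCommutativeRing
  using (fromCommutativeRing; _-Raw-AlmostCommutative⟶_)
open import Data.Fin.Base using (Fin; opposite)
import Data.Fin.Permutation as Perm
import Data.Fin.Properties as Fin
open import Data.Integer.Base using (-1ℤ)
import Data.Integer.Properties as ℤ
import Data.Maybe.Base as Maybe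
import Data.Nat.Base as ℕ
import Data.Nat.Properties as ℕ
open import Data.Product.Base using (_,_)
open import Data.Rational.Base as ℚ using (½; 0ℚ; 1ℚ; toℚᵘ)
import Data.Rational.Properties as ℚ
open import Data.Rational.Unnormalised.Base as ℚᵘ using (mkℚᵘ; *≡*)
import Data.Rational.Unnormalised.Properties as ℚᵘ
open import Function.Base using (_∘_)
open import Relation.Binary.PropositionalEquality as ≡ using (_≡_)
import Relation.Binary.Reasoning.Setoid as SetoidReasoning
open import Relation.Nullary.Decidable using (dec⇒maybe)

-- `_/_` cancels common factors, so for variable `i` and `j` the two sides do not compute to a
-- common fraction. Among unnormalised fractions only an integer identity remains.
/1-homo-+ : ∀ i j → (i + j) / 1 ≡ i / 1 ℚ.+ j / 1
/1-homo-+ i j = ℚ.toℚᵘ-injective (begin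
  toℚᵘ ((i + j) / 1)                ≈⟨ ℚ.toℚᵘ-fromℚᵘ (mkℚᵘ (i + j) 0) ⟩
  mkℚᵘ (i + j) 0                    ≈⟨ *≡* (≡.cong (_* + 1) (≡.cong₂ _+_ (ℤ.*-identityʳ i) (ℤ.*-identityʳ j))) ⟨
  mkℚᵘ i 0 ℚᵘ.+ mkℚᵘ j 0            ≈⟨ ℚᵘ.+-cong (ℚ.toℚᵘ-fromℚᵘ (mkℚᵘ i 0)) (ℚ.toℚᵘ-fromℚᵘ (mkℚᵘ j 0)) ⟨
  toℚᵘ (i / 1) ℚᵘ.+ toℚᵘ (j / 1)    ≈⟨ ℚ.toℚᵘ-homo-+ (i / 1) (j / 1) ⟨
  toℚᵘ (i / 1 ℚ.+ j / 1)            ∎)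
  where open SetoidReasoning ℚᵘ.≃-setoid

/1-homo-* : ∀ i j → (i * j) / 1 ≡ (i / 1) ℚ.* (j / 1)
/1-homo-* i j = ℚ.toℚᵘ-injective (begin
  toℚᵘ ((i * j) / 1)                ≈⟨ ℚ.toℚᵘ-fromℚᵘ (mkℚᵘ (i * j) 0) ⟩
  mkℚᵘ i 0 ℚᵘ.* mkℚᵘ j 0            ≈⟨ ℚᵘ.*-cong (ℚ.toℚᵘ-fromℚᵘ (mkℚᵘ i 0)) (ℚ.toℚᵘ-fromℚᵘ (mkℚᵘ j 0)) ⟨
  toℚᵘ (i / 1) ℚᵘ.* toℚᵘ (j / 1)    ≈⟨ ℚ.toℚᵘ-homo-* (i / 1) (j / 1) ⟨
  toℚᵘ ((i / 1) ℚ.* (j / 1))            ∎)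
  where open SetoidReasoning ℚᵘ.≃-setoid

+m-+n≡+[m∸n] : ∀ {m n} → n ℕ.≤ m → + m - + n ≡ + (m ℕ.∸ n)
+m-+n≡+[m∸n] {m} {n} n≤m = ≡.trans (ℤ.m-n≡m⊖n m n) (ℤ.⊖-≥ n≤m)

-- The argument uses only ring laws and rational constants, so it is carried out over any
-- commutative ring that receives ℚ. With ℚ as coefficients, the solver can also settle steps that
-- involve ½ and 1/10.
module ℚ-Algebra {ℓ₁ ℓ₂} (A : CommutativeRing ℓ₁ ℓ₂)
  (scalars : ℚ.+-*-rawRing -Raw-AlmostCommutative⟶ fromCommutativeRing A) where

  open CommutativeRing A renaming (_+_ to _⊕_; _*_ to _⊛_; _-_ to _⊝_)
  open _-Raw-AlmostCommutative⟶_ scalars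
  open Sum semiring
  open SetoidReasoning setoid
  open RingSolver ℚ.+-*-rawRing (fromCommutativeRing A) scalars
    (λ p q → Maybe.map (reflexive ∘ ≡.cong ⟦_⟧) (dec⇒maybe (p ℚ.≟ q)))
    using (solve; con; _:=_; _:+_; _:*_; _:-_)

  ι : ℤ → Carrier
  ι i = ⟦ i / 1 ⟧

  ι-homo-+ : ∀ i j → ι (i + j) ≈ ι i ⊕ ι j
  ι-homo-+ i j = trans (reflexive (≡.cong ⟦_⟧ (/1-homo-+ i j))) (+-homo (i / 1) (j / 1))

  ι-homo-* : ∀ i j → ι (i * j) ≈ ι i ⊛ ι j
  ι-homo-* i j = trans (reflexive (≡.cong ⟦_⟧ (/1-homo-* i j))) (*-homo (i / 1) (j / 1))

  conv : (f g : ℕ → Carrier) → ℕ → Carrier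
  conv f g n = ∑[ k < ℕ.suc n ] (f (toℕ k) ⊛ g (n ℕ.∸ toℕ k))

  -- Doubling keeps the reversal argument additive; the factor ½ enters only at the end.
  double-weighted-conv : ∀ f n →
    let S = ∑[ k < ℕ.suc n ] (ι (+ toℕ k) ⊛ (f (toℕ k) ⊛ f (n ℕ.∸ toℕ k))) in
    S ⊕ S ≈ ι (+ n) ⊛ conv f f n
  double-weighted-conv f n = begin
    sum t ⊕ sum t                        ≈⟨ +-congˡ (sum-permute t Perm.reverse) ⟩
    sum t ⊕ sum (t ∘ opposite)           ≈⟨ ∑-distrib-+ t (t ∘ opposite) ⟨
    ∑[ k < ℕ.suc n ] (t k ⊕ t (opposite k))    ≈⟨ sum-cong-≋ pair ⟩
    ∑[ k < ℕ.suc n ] (ι (+ n) ⊛ u k)           ≈⟨ *-distribˡ-sum (ι (+ n)) u ⟨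
    ι (+ n) ⊛ conv f f n                 ∎
    where
    u t : Fin (ℕ.suc n) → Carrier
    u k = f (toℕ k) ⊛ f (n ℕ.∸ toℕ k)
    t k = ι (+ toℕ k) ⊛ u k

    pair : ∀ k → t k ⊕ t (opposite k) ≈ ι (+ n) ⊛ u k
    pair k = begin
      t k ⊕ t (opposite k)
        -- `opposite-prop` yields `suc n ∸ suc i`, which computes to `n ∸ i`.
        ≡⟨ ≡.cong (λ j → t k ⊕ ι (+ j) ⊛ (f j ⊛ f (n ℕ.∸ j))) (Fin.opposite-prop k) ⟩
      t k ⊕ ι (+ (n ℕ.∸ i)) ⊛ (f (n ℕ.∸ i) ⊛ f (n ℕ.∸ (n ℕ.∸ i)))
        ≡⟨ ≡.cong (λ j → t k ⊕ ι (+ (n ℕ.∸ i)) ⊛ (f (n ℕ.∸ i) ⊛ f j)) (ℕ.m∸[m∸n]≡n i≤n) ⟩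
      t k ⊕ ι (+ (n ℕ.∸ i)) ⊛ (f (n ℕ.∸ i) ⊛ f i)
        ≈⟨ solve 4 (λ x y a b → x :* (a :* b) :+ y :* (b :* a) := (x :+ y) :* (a :* b)) refl
             (ι (+ i)) (ι (+ (n ℕ.∸ i))) (f i) (f (n ℕ.∸ i)) ⟩
      (ι (+ i) ⊕ ι (+ (n ℕ.∸ i))) ⊛ u k
        ≈⟨ *-congʳ (ι-homo-+ (+ i) (+ (n ℕ.∸ i))) ⟨
      ι (+ (i ℕ.+ (n ℕ.∸ i))) ⊛ u k
        ≡⟨ ≡.cong (λ j → ι (+ j) ⊛ u k) (ℕ.m+[n∸m]≡n i≤n) ⟩
      ι (+ n) ⊛ u k ∎
      where
      i : ℕ
      i = toℕ k
      i≤n : i ℕ.≤ n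
      i≤n = Fin.toℕ≤pred[n] k

  Fibonacci : (ℕ → Carrier) → Set ℓ₂
  Fibonacci f = ∀ n → f (2 ℕ.+ n) ≈ f (1 ℕ.+ n) ⊕ f n

  -- By Binet, f k = αφᵏ + βψᵏ and g k = γφᵏ + δψᵏ with φ, ψ the roots of
  -- x² = x + 1.  If a, b are the first two terms of f, c, d those of g, and
  -- p, q and r, s are the terms n, n + 1 of f and g, then the factor of x + 1 is
  -- 5(αγφⁿ + βδψⁿ), and the other two summands add up to 5(αδ + βγ)F₁₊ₙ.
  conv-value : (x a b c d p q r s : Carrier) → Carrier
  conv-value x a b c d p q r s =
    (x ⊕ ⟦ 1ℚ ⟧) ⊛ (⟦ + 3 / 1 ⟧ ⊛ (a ⊛ r) ⊝ a ⊛ s ⊝ b ⊛ r ⊕ ⟦ + 2 / 1 ⟧ ⊛ (b ⊛ s))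
    ⊕ (c ⊛ (p ⊕ q) ⊝ d ⊛ q)
    ⊕ (a ⊛ (r ⊕ s) ⊝ b ⊛ s)

  -- Only the slots rewritten in the induction vary: `b` receives `f 2`, `s` receives `g (2 + n)`,
  -- and `x` the successor index.
  conv-value-cong : ∀ {x x′ a b b′ c d p q r s s′} → x ≈ x′ → b ≈ b′ → s ≈ s′ →
    conv-value x a b c d p q r s ≈ conv-value x′ a b′ c d p q r s′
  conv-value-cong x≈x′ b≈b′ s≈s′ =
    +-cong
      (+-congʳ
        (*-cong (+-congʳ x≈x′)
          (+-cong
            (+-cong (+-congˡ (-‿cong (*-congˡ s≈s′))) (-‿cong (*-congʳ b≈b′)))
            (*-congˡ (*-cong b≈b′ s≈s′)))))
      (+-cong (*-congˡ (+-congˡ s≈s′)) (-‿cong (*-cong b≈b′ s≈s′)))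

  -- The factor 5 = (φ - ψ)² is the discriminant of x² - x - 1; clearing it leaves integer
  -- coefficients.
  conv-fibonacci : ∀ {f g} → Fibonacci f → Fibonacci g → ∀ n →
    ⟦ + 5 / 1 ⟧ ⊛ conv f g n ≈
      conv-value (ι (+ n)) (f 0) (f 1) (g 0) (g 1) (f n) (f (1 ℕ.+ n)) (g n) (g (1 ℕ.+ n))
  conv-fibonacci {f} {g} fib-f fib-g ℕ.zero =
    trans (*-congˡ (+-identityʳ (f 0 ⊛ g 0)))
      (solve 4 (λ a b c d →
        con (+ 5 / 1) :* (a :* c) :=
          (con 0ℚ :+ con 1ℚ) :*
            (con (+ 3 / 1) :* (a :* c) :- a :* d :- b :* c :+ con (+ 2 / 1) :* (b :* d))
          :+ (c :* (a :+ b) :- d :* b)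
          :+ (a :* (c :+ d) :- b :* d))
        refl (f 0) (f 1) (g 0) (g 1))
  conv-fibonacci {f} {g} fib-f fib-g (ℕ.suc n) = begin
    -- The sum unfolds at its first term, and `suc n ∸ suc k` computes to `n ∸ k`, so the tail pairs
    -- the shifted `f` with the unchanged `g`.
    ⟦ + 5 / 1 ⟧ ⊛ (a ⊛ r ⊕ conv (f ∘ ℕ.suc) g n)
      ≈⟨ distribˡ _ _ _ ⟩
    ⟦ + 5 / 1 ⟧ ⊛ (a ⊛ r) ⊕ ⟦ + 5 / 1 ⟧ ⊛ conv (f ∘ ℕ.suc) g n
      ≈⟨ +-congˡ (conv-fibonacci (fib-f ∘ ℕ.suc) fib-g n) ⟩
    ⟦ + 5 / 1 ⟧ ⊛ (a ⊛ r) ⊕ conv-value x b (f 2) c d p q (g n) r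
      ≈⟨ +-congˡ (conv-value-cong refl (fib-f 0) refl) ⟩
    ⟦ + 5 / 1 ⟧ ⊛ (a ⊛ r) ⊕ conv-value x b (b ⊕ a) c d p q (g n) r
      -- Here `h` is `g n`, and r + h stands for `g (2 + n)`. Both sides have the same factor at x +
      -- 1, namely 2ar - ah + br + 2bh, and the same summand in `c` and `d`. What the extra 1 in the
      -- index contributes is matched by 5ar and the change in the last summand.
      ≈⟨ solve 9 (λ x a b c d p q h r →
           con (+ 5 / 1) :* (a :* r) :+
             ((x :+ con 1ℚ) :*
               (con (+ 3 / 1) :* (b :* h) :- b :* r :- (b :+ a) :* h
                 :+ con (+ 2 / 1) :* ((b :+ a) :* r))
             :+ (c :* (p :+ q) :- d :* q)
             :+ (b :* (h :+ r) :- (b :+ a) :* r))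
           := (con 1ℚ :+ x :+ con 1ℚ) :*
               (con (+ 3 / 1) :* (a :* r) :- a :* (r :+ h) :- b :* r
                 :+ con (+ 2 / 1) :* (b :* (r :+ h)))
             :+ (c :* (p :+ q) :- d :* q)
             :+ (a :* (r :+ (r :+ h)) :- b :* (r :+ h)))
           refl x a b c d p q (g n) r ⟩
    conv-value (⟦ 1ℚ ⟧ ⊕ x) a b c d p q r (r ⊕ g n)
      ≈⟨ conv-value-cong (ι-homo-+ (+ 1) (+ n)) refl (fib-g n) ⟨
    conv-value (ι (+ ℕ.suc n)) a b c d p q r (g (2 ℕ.+ n)) ∎
    where
    x a b c d p q r : Carrier
    x = ι (+ n)
    a = f 0
    b = f 1
    c = g 0
    d = g 1
    p = f (1 ℕ.+ n)
    q = f (2 ℕ.+ n)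
    r = g (1 ℕ.+ n)

  weighted-conv-fibonacci : (G : ℤ → Carrier) →
    (∀ m → G (m + + 2) ≈ G (m + + 1) ⊕ G m) → ∀ n →
    ∑[ k < ℕ.suc n ] (ι (+ toℕ k) ⊛ (G (+ toℕ k) ⊛ G (+ n - + toℕ k))) ≈
      ⟦ + 1 / 10 ⟧ ⊛ ι (+ n) ⊛
        ( (ι (+ 3 * + n + + 5) ⊛ G (+ 0) ⊝ ι (+ n + + 1) ⊛ G (+ 1)) ⊛ G (+ n)
        ⊝ (ι (+ n - + 1) ⊛ G (+ 0) ⊝ ι (+ 2 * + n) ⊛ G (+ 1)) ⊛ G (+ n + + 1))
  weighted-conv-fibonacci G fib-G n = begin
    ∑[ k < ℕ.suc n ] (ι (+ toℕ k) ⊛ (G (+ toℕ k) ⊛ G (+ n - + toℕ k)))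
      ≡⟨ sum-cong-≗ {ℕ.suc n} (λ k → ≡.cong (λ i → ι (+ toℕ k) ⊛ (G (+ toℕ k) ⊛ G i))
           (+m-+n≡+[m∸n] (Fin.toℕ≤pred[n] k))) ⟩
    S
      ≈⟨ solve 1 (λ s → s := con ½ :* (s :+ s)) refl S ⟩
    ⟦ ½ ⟧ ⊛ (S ⊕ S)
      ≈⟨ *-congˡ (double-weighted-conv f n) ⟩
    ⟦ ½ ⟧ ⊛ (x ⊛ conv f f n)
      -- Splitting ½ as 1/10 times 5 supplies the 5 that the closed form needs.
      ≈⟨ solve 2 (λ x t → con ½ :* (x :* t) := con (+ 1 / 10) :* x :* (con (+ 5 / 1) :* t))
           refl x (conv f f n) ⟩
    ⟦ + 1 / 10 ⟧ ⊛ x ⊛ (⟦ + 5 / 1 ⟧ ⊛ conv f f n)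
      ≈⟨ *-congˡ (conv-fibonacci fib-f fib-f n) ⟩
    ⟦ + 1 / 10 ⟧ ⊛ x ⊛ conv-value x a b a b r s r s
      -- For f = g the last two summands of `conv-value` coincide; the rest is collecting the
      -- coefficients of `r` and `s`.
      ≈⟨ *-congˡ (solve 5 (λ x a b r s →
           (x :+ con 1ℚ) :*
             (con (+ 3 / 1) :* (a :* r) :- a :* s :- b :* r :+ con (+ 2 / 1) :* (b :* s))
           :+ (a :* (r :+ s) :- b :* s)
           :+ (a :* (r :+ s) :- b :* s)
           := ((con (+ 3 / 1) :* x :+ con (+ 5 / 1)) :* a :- (x :+ con 1ℚ) :* b) :* r
             :- ((x :+ con (ℚ.- 1ℚ)) :* a :- con (+ 2 / 1) :* x :* b) :* s)
           refl x a b r s) ⟩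
    ⟦ + 1 / 10 ⟧ ⊛ x ⊛
      ( ((⟦ + 3 / 1 ⟧ ⊛ x ⊕ ⟦ + 5 / 1 ⟧) ⊛ a ⊝ (x ⊕ ⟦ 1ℚ ⟧) ⊛ b) ⊛ r
      ⊝ ((x ⊕ ⟦ ℚ.- 1ℚ ⟧) ⊛ a ⊝ ⟦ + 2 / 1 ⟧ ⊛ x ⊛ b) ⊛ s)
      ≈⟨ *-congˡ (+-cong
           (*-congʳ (+-cong
             (*-congʳ (trans (ι-homo-+ (+ 3 * + n) (+ 5)) (+-congʳ (ι-homo-* (+ 3) (+ n)))))
             (-‿cong (*-congʳ (ι-homo-+ (+ n) (+ 1))))))
           (-‿cong (*-cong
             (+-cong
               -- `+ n - + 1` unfolds to `+ n + -1ℤ`, which is why the solved form adds the constant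
               -- `- 1ℚ` instead of subtracting 1.
               (*-congʳ (ι-homo-+ (+ n) -1ℤ))
               (-‿cong (*-congʳ (ι-homo-* (+ 2) (+ n)))))
             (reflexive (≡.cong (G ∘ +_) (ℕ.+-comm n 1)))))) ⟨
    ⟦ + 1 / 10 ⟧ ⊛ x ⊛
      ( (ι (+ 3 * + n + + 5) ⊛ a ⊝ ι (+ n + + 1) ⊛ b) ⊛ r
      ⊝ (ι (+ n - + 1) ⊛ a ⊝ ι (+ 2 * + n) ⊛ b) ⊛ G (+ n + + 1)) ∎
    where
    f : ℕ → Carrier
    f k = G (+ k)

    fib-f : Fibonacci f
    fib-f m = begin
      G (+ (2 ℕ.+ m))              ≡⟨ ≡.cong (G ∘ +_) (ℕ.+-comm 2 m) ⟩
      G (+ (m ℕ.+ 2))              ≈⟨ fib-G (+ m) ⟩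
      G (+ (m ℕ.+ 1)) ⊕ G (+ m)    ≡⟨ ≡.cong (λ i → G (+ i) ⊕ G (+ m)) (ℕ.+-comm m 1) ⟩
      G (+ (1 ℕ.+ m)) ⊕ G (+ m)    ∎

    x a b r s S : Carrier
    x = ι (+ n)
    a = f 0
    b = f 1
    r = f n
    s = f (1 ℕ.+ n)
    S = ∑[ k < ℕ.suc n ] (ι (+ toℕ k) ⊛ (f (toℕ k) ⊛ f (n ℕ.∸ toℕ k)))

≗⇒≈ᴿ : ∀ {x y} → (∀ n → seq x n ≡ seq y n) → x ≈ᴿ y
≗⇒≈ᴿ {x} {y} x≗y = mk≈ λ ε → 0 , λ n _ →
  ≡.subst (λ p → ℚ.∣ p ∣ ℚ.< ε)
    (≡.sym (≡.trans (≡.cong (ℚ._- seq y n) (x≗y n)) (ℚ.+-inverseʳ (seq y n))))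
    (ℚ.positive⁻¹ ε)

ℚ→ℂ-homomorphism : ℚ.+-*-rawRing -Raw-AlmostCommutative⟶ fromCommutativeRing ℂ-commutativeRing
ℚ→ℂ-homomorphism = record
  { ⟦_⟧    = ℚ→ℂ
  ; +-homo = λ p q → mk≈ᶜ (≗⇒≈ᴿ λ _ → ≡.refl) (≗⇒≈ᴿ λ _ → ≡.refl)
  -- The product has real part pq - 0·0 and imaginary part p·0 + 0·q; `- (0ℚ * 0ℚ)` computes to
  -- `0ℚ`.
  ; *-homo = λ p q → mk≈ᶜ
      (≗⇒≈ᴿ λ _ → ≡.sym (ℚ.+-identityʳ (p ℚ.* q)))
      (≗⇒≈ᴿ λ _ → ≡.sym (≡.cong₂ ℚ._+_ (ℚ.*-zeroʳ p) (ℚ.*-zeroˡ q)))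
  ; -‿homo = λ p → mk≈ᶜ (≗⇒≈ᴿ λ _ → ≡.refl) (≗⇒≈ᴿ λ _ → ≡.refl)
  ; 0-homo = refl
  ; 1-homo = refl
  }
  where open CommutativeRing ℂ-commutativeRing using (refl)

mainTheorem10 : (G : ℤ → ℂ) → IsGeneralizedFibonacci G → (n : ℕ) →
    ∑[ k ≤ n ] (ℤ→ℂ (+ toℕ k) *ᶜ (G (+ toℕ k) *ᶜ G (+ n - + toℕ k)))
    ≈ᶜ ℚ→ℂ (+ 1 / 10) *ᶜ ℤ→ℂ (+ n) *ᶜ
    ( (ℤ→ℂ (+ 3 * + n + + 5) *ᶜ G (+ 0) -ᶜ ℤ→ℂ (+ n + + 1) *ᶜ G (+ 1)) *ᶜ G (+ n)
    -ᶜ (ℤ→ℂ (+ n - + 1) *ᶜ G (+ 0) -ᶜ ℤ→ℂ (+ 2 * + n) *ᶜ G (+ 1)) *ᶜ G (+ n + + 1))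
-- Over ℂ with these scalars `ι` unfolds to `ℤ→ℂ`, and `∑[ k ≤ n ]` agrees by computation with the
-- sum over `k < suc n`.
mainTheorem10 = weighted-conv-fibonacci
  where open ℚ-Algebra ℂ-commutativeRing ℚ→ℂ-homomorphism
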